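{- Let $f\colon L\times R\to T$ where $L$, $R$ and $T$ are finite sets. Then there is a cyclic partition $\mathcal{P}$ of $f$ such that $\mathrm{cost}(\mathcal{P})\le\frac{|L|}{2}\cdot\left(|R|+\frac{|T|}{2}\right)$ when $|L|$ is even, and $\mathrm{cost}(\mathcal{P})\le|R|+\frac{|L|-1}{2}\cdot\left(|R|+\frac{|T|}{2}\right)$ when $|L|$ is odd.
   Context: For $k\in\mathbb{N}$ let $\mathbb{Z}_k=\{0,1,\ldots,k-1\}$. A function $f\colon A\times B\to C$ is $k$-cyclic if there are functions $\sigma_A\colon A\to\mathbb{Z}_k$, $\sigma_B\colon B\to\mathbb{Z}_k$ and $\sigma_C\colon\mathbb{Z}_k\to C$ such that $f(a,b)=\sigma_C(\sigma_A(a)+\sigma_B(b)\bmod k)$ for all $a\in A$, $b\in B$. For $f\colon L\times R\to T$, a triple $(A,B,k)$ with $A\subseteq L$, $B\subseteq R$, $k\in\mathbb{N}$, is a cyclic minor of $f$ if the restriction of $f$ to $A\times B$ is $k$-cyclic. A cyclic partition of $f$ is a set $\mathcal{P}=\{(A_1,B_1,k_1),\ldots,(A_m,B_m,k_m)\}$ of cyclic minors of $f$ such that for every $(a,b)\in L\times R$ there is a unique $1\le i\le m$ with $(a,b)\in A_i\times B_i$. Its cost is $\mathrm{cost}(\mathcal{P})=\sum_{i=1}^m k_i$. -}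

module Defs where

open import Data.Bool using (Bool) renaming (T to IsTrue)
open import Data.Fin using (Fin; toℕ)
open import Data.List using (List; length; lookup; map; sum)
open import Data.Nat using (ℕ; suc; _+_)
open import Data.Nat.DivMod using (_mod_)
open import Data.Product using (Σ-syntax; ∃-syntax; ∃!; _×_; _,_)
open import Level using (Level; _⊔_)
open import Relation.Binary.PropositionalEquality using (_≡_)

private
  variable
    a b c : Level

-- ℤ_k is Fin k.  There is no clause for k = 0, since Fin 0 is empty.
infixl 6 _⊕_
_⊕_ : {k : ℕ} → Fin k → Fin k → Fin k
_⊕_ {suc k} i j = (toℕ i + toℕ j) mod suc k

Cyclic : {A : Set a} {B : Set b} {C : Set c} → ℕ → (A × B → C) → Set (a ⊔ b ⊔ c)
Cyclic {A = A} {B} {C} k f =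
  Σ[ σA ∈ (A → Fin k) ] Σ[ σB ∈ (B → Fin k) ] Σ[ σC ∈ (Fin k → C) ]
    (∀ x y → f (x , y) ≡ σC (σA x ⊕ σB y))

-- Subsets are given by characteristic functions, so that membership is
-- decidable and has at most one proof.
Subset : Set a → Set a
Subset X = X → Bool

infix 4 _∈_
_∈_ : {X : Set a} → X → Subset X → Set
x ∈ S = IsTrue (S x)

Elements : {X : Set a} → Subset X → Set a
Elements S = ∃[ x ] x ∈ S

restrict : {L : Set a} {R : Set b} {T : Set c} → (L × R → T) →
           (A : Subset L) (B : Subset R) → Elements A × Elements B → T
restrict f A B ((x , _) , (y , _)) = f (x , y)

record CyclicMinor {L : Set a} {R : Set b} {T : Set c} (f : L × R → T) :
                   Set (a ⊔ b ⊔ c) where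
  field
    A      : Subset L
    B      : Subset R
    k      : ℕ
    cyclic : Cyclic k (restrict f A B)

-- The minors are listed rather than collected in a set.  As a cell lies in the
-- rectangle of exactly one index, only minors with an empty rectangle can be
-- repeated, and every repetition is counted in the cost.
record CyclicPartition {L : Set a} {R : Set b} {T : Set c} (f : L × R → T) :
                       Set (a ⊔ b ⊔ c) where
  field
    minors : List (CyclicMinor f)
    cover  : ∀ x y → ∃! _≡_ λ (i : Fin (length minors)) →
               x ∈ CyclicMinor.A (lookup minors i) × y ∈ CyclicMinor.B (lookup minors i)

cost : {L : Set a} {R : Set b} {T : Set c} {f : L × R → T} → CyclicPartition f → ℕ
cost P = sum (map CyclicMinor.k (CyclicPartition.minors P))

{-# OPTIONS --safe #-}
module Submission where

-- Treat the rows in pairs.  A pair of rows g, h : R → T is a directed multigraph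
-- on T with an edge g y → h y for every y ∈ R; let o v and i v be the out- and
-- indegree of v.
--  * Covering both rows separately by their fibres costs Σ_v [o v > 0] + [i v > 0].
--  * Joining edges greedily to walks and covering every walk by one cyclic minor
--    (a walk with m edges costs m if it is closed and m + 1 otherwise) costs at
--    most Σ_v max (o v) (i v).
-- For every v the two contributions add up to at most 1 + o v + i v, so the two
-- costs add up to at most |T| + 2|R|, and the cheaper one is at most |R| + |T|/2.
-- A row left over costs its number of values, which is at most |R|.

open import Defs
open import Data.Bool using (Bool; true; false; if_then_else_; _∧_; _∨_) renaming (T to IsTrue)
open import Data.Bool.Properties using (T-∧)
open import Data.Fin using (Fin; zero; suc; toℕ; _≟_; _↑ˡ_; _↑ʳ_; splitAt)
open import Data.Fin.Properties using (toℕ-fromℕ<; splitAt⁻¹-↑ˡ; splitAt⁻¹-↑ʳ)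
open import Data.Integer using (+_; _-_)
import Data.Integer as ℤ
import Data.Integer.Properties as ℤ
open import Data.List using (List; []; _∷_; _++_; map; filter; allFin; length; lookup)
open import Data.List.Membership.Propositional using () renaming (_∈_ to _∈ᴸ_)
open import Data.List.Membership.Propositional.Properties using (∈-allFin; ∈-lookup)
open import Data.List.Properties using (map-cong; map-∘; map-++; map-tabulate; length-tabulate)
open import Data.List.Relation.Binary.Permutation.Propositional using (_↭_; ↭-trans; prep; swap; refl)
open import Data.List.Relation.Binary.Permutation.Propositional.Properties using (map⁺; ↭-length)
open import Data.List.Relation.Unary.All as All using (All; []; _∷_)
open import Data.List.Relation.Unary.All.Properties using (¬Any⇒All¬)
open import Data.List.Relation.Unary.Any using (Any; here; there; any?)
open import Data.Maybe using (Maybe; just; nothing; maybe′)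
open import Data.Nat using (ℕ; zero; suc; z≤n; s≤s; _⊔_; _%_; _≤?_)
  renaming (_+_ to _+ℕ_; _*_ to _*ℕ_; _≤_ to _≤ℕ_)
open import Data.Nat.Divisibility using (_∣_; _∤_; divides)
open import Data.Nat.DivMod using (_mod_; m<n⇒m%n≡m; n%n≡0; m%n<n; %-distribˡ-+)
open import Data.Nat.ListAction using (sum)
open import Data.Nat.ListAction.Properties using (sum-++; sum-↭)
import Data.Nat.Properties as ℕ
open import Data.Nat.Tactic.RingSolver using (solve-∀)
open import Data.Product using (_×_; Σ-syntax; ∃-syntax; ∃!; _,_; proj₁)
open import Data.Rational using (_/_; _+_; _*_; _≤_; toℚᵘ)
import Data.Rational.Properties as ℚ
open import Data.Rational.Unnormalised using (ℚᵘ; mkℚᵘ; _≃_; *≤*; ↥_; ↧_)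
import Data.Rational.Unnormalised as ℚᵘ
import Data.Rational.Unnormalised.Properties as ℚᵘ
open import Data.Sum using (_⊎_; inj₁; inj₂; [_,_]′)
open import Function using (_∘_; const; id)
open import Function.Bundles using (_↔_; Inverse; Equivalence)
open import Level using (Level)
open import Relation.Binary.PropositionalEquality
open import Relation.Nullary using (¬_; Dec; yes; no; does; contradiction)
open import Relation.Unary using (Decidable)

private
  variable
    a b c a′ b′ c′ : Level
    X Y : Set a
    L : Set a
    R : Set b
    T : Set c
    l m n r t : ℕ

open CyclicMinor

-- Finite sums and counting with indicators.

ind : Bool → ℕ
ind b = if b then 1 else 0

δ : Fin n → Fin n → ℕ
δ i j = ind (does (i ≟ j))

∑ : List X → (X → ℕ) → ℕ
∑ xs h = sum (map h xs)

∑-cong : {g h : X → ℕ} (xs : List X) → (∀ x → g x ≡ h x) → ∑ xs g ≡ ∑ xs h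
∑-cong xs eq = cong sum (map-cong eq xs)

∑-mono : {g h : X → ℕ} (xs : List X) → (∀ x → g x ≤ℕ h x) → ∑ xs g ≤ℕ ∑ xs h
∑-mono []       le = z≤n
∑-mono (x ∷ xs) le = ℕ.+-mono-≤ (le x) (∑-mono xs le)

∑-map : (p : X → Y) (h : Y → ℕ) (xs : List X) → ∑ (map p xs) h ≡ ∑ xs (h ∘ p)
∑-map p h xs = cong sum (sym (map-∘ xs))

∑-++ : (h : X → ℕ) (xs ys : List X) → ∑ (xs ++ ys) h ≡ ∑ xs h +ℕ ∑ ys h
∑-++ h xs ys = trans (cong sum (map-++ h xs ys)) (sum-++ (map h xs) (map h ys))

∑-↭ : (h : X → ℕ) {xs ys : List X} → xs ↭ ys → ∑ xs h ≡ ∑ ys h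
∑-↭ h p = sum-↭ (map⁺ h p)

∑-const : (k : ℕ) (xs : List X) → ∑ xs (const k) ≡ length xs *ℕ k
∑-const k []       = refl
∑-const k (x ∷ xs) = cong (k +ℕ_) (∑-const k xs)

∑-+ : (g h : X → ℕ) (xs : List X) → ∑ xs (λ x → g x +ℕ h x) ≡ ∑ xs g +ℕ ∑ xs h
∑-+ g h []       = refl
∑-+ g h (x ∷ xs) = trans (cong (g x +ℕ h x +ℕ_) (∑-+ g h xs)) (interchange (g x) (h x) _ _)
  where
  interchange : ∀ p q u v → p +ℕ q +ℕ (u +ℕ v) ≡ p +ℕ u +ℕ (q +ℕ v)
  interchange = solve-∀

∑-swap : (h : X → Y → ℕ) (xs : List X) (ys : List Y) →
         ∑ xs (λ x → ∑ ys (h x)) ≡ ∑ ys (λ y → ∑ xs (λ x → h x y))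
∑-swap h []       ys = sym (trans (∑-const 0 ys) (ℕ.*-zeroʳ (length ys)))
∑-swap h (x ∷ xs) ys = trans (cong (∑ ys (h x) +ℕ_) (∑-swap h xs ys)) (sym (∑-+ (h x) _ ys))

∑-filter : {P : X → Set a} (P? : Decidable P) (h : X → ℕ) (xs : List X) →
           ∑ (filter P? xs) h ≡ ∑ xs (λ x → ind (does (P? x)) *ℕ h x)
∑-filter P? h []       = refl
∑-filter P? h (x ∷ xs) with does (P? x)
... | true  = cong₂ _+ℕ_ (sym (ℕ.+-identityʳ (h x))) (∑-filter P? h xs)
... | false = ∑-filter P? h xs

∑-∈ : (h : X → ℕ) {x : X} {xs : List X} → x ∈ᴸ xs → h x ≤ℕ ∑ xs h
∑-∈ h (here refl)  = ℕ.m≤m+n _ _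
∑-∈ h (there x∈xs) = ℕ.≤-trans (∑-∈ h x∈xs) (ℕ.m≤n+m _ _)

∑-zero : {h : X → ℕ} {xs : List X} → All (λ x → h x ≡ 0) xs → ∑ xs h ≡ 0
∑-zero []       = refl
∑-zero (z ∷ zs) = cong₂ _+ℕ_ z (∑-zero zs)

length-allFin : ∀ n → length (allFin n) ≡ n
length-allFin n = length-tabulate {n = n} id

∑-allFin-suc : (h : Fin (suc n) → ℕ) → ∑ (allFin (suc n)) h ≡ h zero +ℕ ∑ (allFin n) (h ∘ suc)
∑-allFin-suc h = cong (λ xs → h zero +ℕ sum xs)
  (trans (map-tabulate suc h) (sym (map-tabulate id (h ∘ suc))))

∑-δ : (i : Fin n) → ∑ (allFin n) (δ i) ≡ 1
∑-δ {suc n} zero    = trans (∑-allFin-suc {n} (δ zero))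
  (cong suc (trans (∑-const 0 (allFin n)) (ℕ.*-zeroʳ (length (allFin n)))))
∑-δ {suc n} (suc i) = trans (∑-allFin-suc (δ (suc i))) (∑-δ i)

witness : {P : Set a} (P? : Dec P) → IsTrue (does P?) → P
witness (yes p) _ = p

IsTrue⇒ind : ∀ {b} → IsTrue b → ind b ≡ 1
IsTrue⇒ind {true} _ = refl

-- A true head uses up the whole sum, so the rest sums to 0 and no later position can be true.
-- Positions are counted rather than values, so repeated list entries stay distinct.
ind≡1⇒∃! : (h : X → Bool) (xs : List X) → ∑ xs (ind ∘ h) ≡ 1 →
           ∃! _≡_ λ (i : Fin (length xs)) → IsTrue (h (lookup xs i))
ind≡1⇒∃! h (x ∷ xs) eq with h x in hx
... | true  = zero , subst IsTrue (sym hx) _ , unique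
  where
  unique : ∀ {i} → IsTrue (h (lookup (x ∷ xs) i)) → zero ≡ i
  unique {zero}  _ = refl
  unique {suc i} p with () ← subst₂ _≤ℕ_ (IsTrue⇒ind p) (ℕ.suc-injective eq)
    (∑-∈ (ind ∘ h) (∈-lookup {xs = xs} i))
... | false with i , p , unique ← ind≡1⇒∃! h xs eq = suc i , p , unique′
  where
  unique′ : ∀ {j} → IsTrue (h (lookup (x ∷ xs) j)) → suc i ≡ j
  unique′ {zero}  q with () ← subst IsTrue hx q
  unique′ {suc j} q = cong suc (unique q)

-- Tilings by cyclic minors, and pulling minors back along maps.

module _ {L : Set a} {R : Set b} {T : Set c} {f : L × R → T} where

  contains : CyclicMinor f → L → R → Bool
  contains M x y = A M x ∧ B M y

  multiplicity : List (CyclicMinor f) → L → R → ℕ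
  multiplicity Ms x y = ∑ Ms (λ M → ind (contains M x y))

  size : List (CyclicMinor f) → ℕ
  size Ms = ∑ Ms k

-- Unique coverage is counted, since multiplicities add up when lists of minors
-- are concatenated.
record Tiling {L : Set a} {R : Set b} {T : Set c} (f : L × R → T) : Set (a Level.⊔ b Level.⊔ c) where
  constructor tiling
  field
    tiles : List (CyclicMinor f)
    once  : ∀ x y → multiplicity tiles x y ≡ 1

open Tiling

toPartition : {f : L × R → T} → Tiling f → CyclicPartition f
toPartition (tiling Ms once) = record
  { minors = Ms
  ; cover  = λ x y → let i , p , unique = ind≡1⇒∃! (λ M → contains M x y) Ms (once x y) in
      i , Equivalence.to T-∧ p , λ q → unique (Equivalence.from T-∧ q)
  }

module _ {L : Set a} {R : Set b} {T : Set c} {L′ : Set a′} {R′ : Set b′} {T′ : Set c′}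
         {f : L × R → T} {f′ : L′ × R′ → T′}
         (p : L → Maybe L′) (q : R → R′) (g : T′ → T)
         (agree : ∀ x y {x′} → p x ≡ just x′ → f (x , y) ≡ g (f′ (x′ , q y))) where

  private
    descend : (S : Subset L′) (x : L) → IsTrue (maybe′ S false (p x)) →
              ∃[ x′ ] x′ ∈ S × p x ≡ just x′
    descend S x h with p x
    ... | just x′ = x′ , h , refl

  -- The row map is partial so that one construction serves two purposes: placing the minors of a
  -- block of rows in a larger matrix, and transporting minors along bijections. Rows sent to
  -- `nothing` lie in no pulled-back minor.
  pull : CyclicMinor f′ → CyclicMinor f
  pull M with σA , σB , σC , eq ← cyclic M = record
    { A      = maybe′ (A M) false ∘ p
    ; B      = B M ∘ q
    ; k      = k M
    ; cyclic = (λ (x , h) → let x′ , h′ , _ = descend (A M) x h in σA (x′ , h′))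
             , (λ (y , h) → σB (q y , h))
             , g ∘ σC
             , λ (x , h) (y , h′) → let x′ , h″ , px = descend (A M) x h in
                 trans (agree x y px) (cong g (eq (x′ , h″) (q y , h′)))
    }

  multiplicity-pull : ∀ Ms x y → multiplicity (map pull Ms) x y ≡
                      maybe′ (λ x′ → multiplicity Ms x′ (q y)) 0 (p x)
  multiplicity-pull Ms x y = trans (∑-map pull _ Ms) go
    where
    go : ∑ Ms (λ M → ind (maybe′ (A M) false (p x) ∧ B M (q y))) ≡
         maybe′ (λ x′ → multiplicity Ms x′ (q y)) 0 (p x)
    go with p x
    ... | just x′ = refl
    ... | nothing = trans (∑-const 0 Ms) (ℕ.*-zeroʳ (length Ms))

  size-pull : ∀ Ms → size (map pull Ms) ≡ size Ms
  size-pull Ms = ∑-map pull k Ms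

-- Every row belongs to exactly one of the two blocks, so of the two multiplicities at a cell one is
-- 1 and the other is 0.
stack : {R : Set b} {T : Set c} (f : Fin (m +ℕ n) × R → T)
        (P : Tiling (λ (i , y) → f (i ↑ˡ n , y))) (Q : Tiling (λ (j , y) → f (m ↑ʳ j , y))) →
        Σ[ S ∈ Tiling f ] size (tiles S) ≡ size (tiles P) +ℕ size (tiles Q)
stack {m = m} {n = n} f P Q = tiling (map pullˡ (tiles P) ++ map pullʳ (tiles Q)) once′ , sizes
  where
  top : Fin (m +ℕ n) → Maybe (Fin m)
  top x = [ just , const nothing ]′ (splitAt m x)

  bottom : Fin (m +ℕ n) → Maybe (Fin n)
  bottom x = [ const nothing , just ]′ (splitAt m x)

  top-agree : ∀ x y {i} → top x ≡ just i → f (x , y) ≡ f (i ↑ˡ n , y)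
  top-agree x y eq with splitAt m x in s
  top-agree x y refl | inj₁ i = cong (λ z → f (z , y)) (sym (splitAt⁻¹-↑ˡ s))

  bottom-agree : ∀ x y {j} → bottom x ≡ just j → f (x , y) ≡ f (m ↑ʳ j , y)
  bottom-agree x y eq with splitAt m x in s
  bottom-agree x y refl | inj₂ j = cong (λ z → f (z , y)) (sym (splitAt⁻¹-↑ʳ {m} s))

  pullˡ = pull top id id top-agree
  pullʳ = pull bottom id id bottom-agree

  once′ : ∀ x y → multiplicity (map pullˡ (tiles P) ++ map pullʳ (tiles Q)) x y ≡ 1
  once′ x y = trans (∑-++ _ (map pullˡ (tiles P)) _) (trans
    (cong₂ _+ℕ_ (multiplicity-pull top id id top-agree (tiles P) x y)
                (multiplicity-pull bottom id id bottom-agree (tiles Q) x y)) go)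
    where
    go : maybe′ (λ i → multiplicity (tiles P) i y) 0 (top x) +ℕ
         maybe′ (λ j → multiplicity (tiles Q) j y) 0 (bottom x) ≡ 1
    go with splitAt m x
    ... | inj₁ i = trans (ℕ.+-identityʳ _) (once P i y)
    ... | inj₂ j = once Q j y

  sizes = trans (∑-++ k (map pullˡ (tiles P)) _)
    (cong₂ _+ℕ_ (size-pull top id id top-agree (tiles P))
                (size-pull bottom id id bottom-agree (tiles Q)))

-- Fibres, and tiling identical rows by them.

fibreSize : (Fin r → Fin t) → Fin t → ℕ
fibreSize h v = ∑ (allFin _) (λ j → δ (h j) v)

-- Double counting: each column lies in exactly one fibre.
∑-fibreSize : (h : Fin r → Fin t) → ∑ (allFin t) (fibreSize h) ≡ r
∑-fibreSize {r} {t} h = begin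
  ∑ (allFin t) (λ v → ∑ (allFin r) (λ j → δ (h j) v))  ≡⟨ ∑-swap (λ v j → δ (h j) v) (allFin t) (allFin r) ⟩
  ∑ (allFin r) (λ j → ∑ (allFin t) (δ (h j)))          ≡⟨ ∑-cong (allFin r) (λ j → ∑-δ (h j)) ⟩
  ∑ (allFin r) (const 1)                               ≡⟨ ∑-const 1 (allFin r) ⟩
  length (allFin r) *ℕ 1                               ≡⟨ ℕ.*-identityʳ _ ⟩
  length (allFin r)                                    ≡⟨ length-allFin r ⟩
  r                                                    ∎
  where open ≡-Reasoning

hit : ℕ → ℕ
hit n = ind (does (1 ≤? n))

hit≤ : ∀ n → hit n ≤ℕ n
hit≤ zero    = z≤n
hit≤ (suc n) = s≤s z≤n

imageSize : (Fin r → Fin t) → ℕ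
imageSize {t = t} h = ∑ (allFin t) (hit ∘ fibreSize h)

imageSize≤r : (h : Fin r → Fin t) → imageSize h ≤ℕ r
imageSize≤r {r} {t} h = subst (imageSize h ≤ℕ_) (∑-fibreSize h)
  (∑-mono (allFin t) (λ v → hit≤ (fibreSize h v)))

-- On a fibre of `h` the function is constant, hence 1-cyclic. Only nonempty fibres are listed,
-- because an empty one would also cost 1.
fibreTiling : {f : L × Fin r → Fin t} (h : Fin r → Fin t) → (∀ x j → f (x , j) ≡ h j) →
              Σ[ P ∈ Tiling f ] size (tiles P) ≡ imageSize h
fibreTiling {r = r} {t} {f} h f≡h = tiling (map fibre image) once′ , size′
  where
  image = filter (λ v → 1 ≤? fibreSize h v) (allFin t)

  fibre : Fin t → CyclicMinor f
  fibre v = record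
    { A      = const true
    ; B      = λ j → does (h j ≟ v)
    ; k      = 1
    ; cyclic = const zero , const zero , const v
             , λ (x , _) (j , p) → trans (f≡h x j) (witness (h j ≟ v) p)
    }

  -- Dropping the empty fibres does not affect the covering: if the fibre of `v` is empty, then
  -- `h j` differs from `v` and the right-hand side is 0 as well.
  absorb : ∀ j v → hit (fibreSize h v) *ℕ δ (h j) v ≡ δ (h j) v
  absorb j v with fibreSize h v in eq
  ... | suc _ = ℕ.+-identityʳ _
  ... | zero  = sym (ℕ.n≤0⇒n≡0 (subst (δ (h j) v ≤ℕ_) eq (∑-∈ (λ i → δ (h i) v) (∈-allFin j))))

  once′ : ∀ x j → multiplicity (map fibre image) x j ≡ 1
  once′ x j = begin
    multiplicity (map fibre image) x j                          ≡⟨ ∑-map fibre _ image ⟩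
    ∑ image (δ (h j))                                           ≡⟨ ∑-filter _ _ (allFin t) ⟩
    ∑ (allFin t) (λ v → hit (fibreSize h v) *ℕ δ (h j) v)       ≡⟨ ∑-cong (allFin t) (absorb j) ⟩
    ∑ (allFin t) (δ (h j))                                      ≡⟨ ∑-δ (h j) ⟩
    1                                                           ∎
    where open ≡-Reasoning

  size′ : size (map fibre image) ≡ imageSize h
  size′ = trans (∑-map fibre k image) (trans (∑-filter _ _ (allFin t))
    (∑-cong (allFin t) (λ v → ℕ.*-identityʳ (hit (fibreSize h v)))))

-- Splicing vertex sequences, and auxiliary facts for walks.

-- The vertices of a walk with m + 1 edges followed by another walk.
splice : ℕ → (ℕ → X) → (ℕ → X) → ℕ → X
splice m       v w zero    = v zero
splice zero    v w (suc p) = w p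
splice (suc m) v w (suc p) = splice m (v ∘ suc) w p

-- At index `suc m` the spliced sequence already reads from `w`; the hypothesis that the walks meet
-- makes this agree with `v`.
splice-left : ∀ m (v w : ℕ → X) → v (suc m) ≡ w 0 → ∀ {p} → p ≤ℕ suc m → splice m v w p ≡ v p
splice-left m       v w eq {zero}      le       = refl
splice-left zero    v w eq {suc zero}  le       = sym eq
splice-left zero    v w eq {suc (suc p)} (s≤s ())
splice-left (suc m) v w eq {suc p}     (s≤s le) = splice-left m (v ∘ suc) w eq le

splice-right : ∀ m (v w : ℕ → X) p → splice m v w (suc m +ℕ p) ≡ w p
splice-right zero    v w p = refl
splice-right (suc m) v w p = splice-right m (v ∘ suc) w p

toℕ-⊕-mod : ∀ k i j → toℕ ((i mod suc k) ⊕ (j mod suc k)) ≡ (i +ℕ j) % suc k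
toℕ-⊕-mod k i j = begin
  toℕ ((i mod suc k) ⊕ (j mod suc k))                ≡⟨ toℕ-fromℕ< _ ⟩
  (toℕ (i mod suc k) +ℕ toℕ (j mod suc k)) % suc k   ≡⟨ cong₂ (λ x y → (x +ℕ y) % suc k) (toℕ-fromℕ< (m%n<n i (suc k))) (toℕ-fromℕ< (m%n<n j (suc k))) ⟩
  (i % suc k +ℕ j % suc k) % suc k                   ≡⟨ %-distribˡ-+ i j (suc k) ⟨
  (i +ℕ j) % suc k                                   ∎
  where open ≡-Reasoning

extract : {P : X → Set a} {xs : List X} → Any P xs → ∃[ x ] ∃[ ys ] P x × xs ↭ x ∷ ys
extract {xs = x ∷ xs} (here px) = x , xs , px , refl
extract {xs = x ∷ xs} (there p) with y , ys , py , perm ← extract p =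
  y , x ∷ ys , py , ↭-trans (prep x perm) (swap x y refl)

ind-∨ : ∀ b c → ind b +ℕ ind c ≤ℕ 1 → ind (b ∨ c) ≡ ind b +ℕ ind c
ind-∨ true  true  (s≤s ())
ind-∨ true  false _ = refl
ind-∨ false c     _ = refl

-- At `u` the maximum is attained by the first argument since `e u` is 0, so raising that argument
-- raises the maximum by one. The situation at `w` is symmetric, and nothing changes elsewhere.
δ-⊔-separate : (u w : Fin n) (s e : Fin n → ℕ) → u ≢ w → e u ≡ 0 → s w ≡ 0 → ∀ v →
               δ u v +ℕ δ w v +ℕ (s v ⊔ e v) ≤ℕ (δ u v +ℕ s v) ⊔ (δ w v +ℕ e v)
δ-⊔-separate u w s e u≢w eu sw v with u ≟ v | w ≟ v
... | yes refl | yes refl = contradiction refl u≢w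
... | yes refl | no _     rewrite eu | ℕ.⊔-identityʳ (s v) = ℕ.≤-refl
... | no _     | yes refl rewrite sw = ℕ.≤-refl
... | no _     | no _     = ℕ.≤-refl

-- Walks in the multigraph of two rows, and their cyclic minors.

module _ (f : Fin 2 × Fin r → Fin t) where

  private
    g₁ g₂ : Fin r → Fin t
    g₁ j = f (zero , j)
    g₂ j = f (suc zero , j)

  -- The walk has inner + 1 edges; vertex is junk beyond inner + 1.  An index j
  -- stands for the edge g₁ j → g₂ j, and parallel edges may share a position.
  record Walk : Set where
    field
      inner    : ℕ
      vertex   : ℕ → Fin t
      edges    : Subset (Fin r)
      position : ∀ j → j ∈ edges → ∃[ p ] p ≤ℕ inner × vertex p ≡ g₁ j × vertex (suc p) ≡ g₂ j

    source target : Fin t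
    source = vertex 0
    target   = vertex (suc inner)

  open Walk

  edge : Fin r → Walk
  edge i = record
    { inner    = 0
    ; vertex   = λ { zero → g₁ i ; (suc _) → g₂ i }
    ; edges    = λ j → does (j ≟ i)
    ; position = λ j h → 0 , z≤n , cong g₁ (sym (witness (j ≟ i) h)) , cong g₂ (sym (witness (j ≟ i) h))
    }

  join : (P Q : Walk) → target P ≡ source Q → Walk
  join P Q eq = record
    -- The edge numbers `inner P + 1` and `inner Q + 1` add up to one more than this value.
    { inner    = suc (inner P +ℕ inner Q)
    ; vertex   = joined
    ; edges    = λ j → edges P j ∨ edges Q j
    ; position = pos
    }
    where
    joined = splice (inner P) (vertex P) (vertex Q)

    -- Edges of `P` keep their position, and the others are shifted by the `suc (inner P)` edges of
    -- `P`.
    pos : ∀ j → IsTrue (edges P j ∨ edges Q j) →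
          ∃[ p ] p ≤ℕ suc (inner P +ℕ inner Q) × joined p ≡ g₁ j × joined (suc p) ≡ g₂ j
    pos j h with edges P j in eP
    ... | true  with p , p≤ , eq₁ , eq₂ ← position P j (subst IsTrue (sym eP) _) =
      p , ℕ.m≤n⇒m≤1+n (ℕ.m≤n⇒m≤n+o _ p≤) ,
      trans (splice-left (inner P) (vertex P) (vertex Q) eq (ℕ.m≤n⇒m≤1+n p≤)) eq₁ ,
      trans (splice-left (inner P) (vertex P) (vertex Q) eq (s≤s p≤)) eq₂
    ... | false with p , p≤ , eq₁ , eq₂ ← position Q j h =
      suc (inner P) +ℕ p , s≤s (ℕ.+-monoʳ-≤ (inner P) p≤) ,
      trans (splice-right (inner P) (vertex P) (vertex Q) p) eq₁ ,
      trans (trans (cong joined (sym (ℕ.+-suc (suc (inner P)) p)))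
                   (splice-right (inner P) (vertex P) (vertex Q) (suc p))) eq₂

  target-join : ∀ P Q eq → target (join P Q eq) ≡ target Q
  target-join P Q eq = trans (cong (splice (inner P) (vertex P) (vertex Q)) (sym (ℕ.+-suc (suc (inner P)) (inner Q))))
                          (splice-right (inner P) (vertex P) (vertex Q) (suc (inner Q)))

  -- Rows 0 and 1 get the residues 0 and 1, a column gets the position `p` of its edge, and a
  -- residue is read as the vertex with that index. The sums `p` and `p + 1` then name the two ends
  -- of the edge. The bound on `inner P` keeps `p` below the modulus `suc k`, and `wrap` takes care
  -- of `p + 1`.
  walkMinor : (P : Walk) (k : ℕ) → inner P ≤ℕ k →
              (∀ p → p ≤ℕ inner P → vertex P (suc p % suc k) ≡ vertex P (suc p)) → CyclicMinor f
  walkMinor P k inner≤k wrap = record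
    { A      = const true
    ; B      = edges P
    ; k      = suc k
    ; cyclic = (λ (x , _) → toℕ x mod suc k)
             , (λ (j , h) → proj₁ (position P j h) mod suc k)
             , vertex P ∘ toℕ
             , λ (x , _) (j , h) → eq x j h
    }
    where
    eq : ∀ x j h → f (x , j) ≡
         vertex P (toℕ ((toℕ x mod suc k) ⊕ (proj₁ (position P j h) mod suc k)))
    eq x j h with p , p≤ , eq₁ , eq₂ ← position P j h
             rewrite toℕ-⊕-mod k (toℕ x) p with x
    ... | zero     = trans (sym eq₁) (cong (vertex P) (sym (m<n⇒m%n≡m (s≤s (ℕ.≤-trans p≤ inner≤k)))))
    ... | suc zero = trans (sym eq₂) (sym (wrap p p≤))

  -- There are as many residues as edges, so only the last edge wraps around. Its far end is read at
  -- index 0, which is correct because the walk is closed.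
  closedMinor : (P : Walk) → target P ≡ source P → CyclicMinor f
  closedMinor P closed = walkMinor P (inner P) ℕ.≤-refl wrap
    where
    wrap : ∀ p → p ≤ℕ inner P → vertex P (suc p % suc (inner P)) ≡ vertex P (suc p)
    wrap p p≤ with ℕ.m≤n⇒m<n∨m≡n p≤
    ... | inj₁ p<   = cong (vertex P) (m<n⇒m%n≡m (s≤s p<))
    ... | inj₂ refl = trans (cong (vertex P) (n%n≡0 (suc p))) (sym closed)

  -- One residue more than there are edges, so `p + 1` never reaches the modulus.
  openMinor : Walk → CyclicMinor f
  openMinor P = walkMinor P (suc (inner P)) (ℕ.n≤1+n _)
    (λ p p≤ → cong (vertex P) (m<n⇒m%n≡m (s≤s (s≤s p≤))))

  -- Loads and budgets of lists of walks.

  load : List Walk → Fin r → ℕ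
  load W j = ∑ W (λ P → ind (edges P j))

  starts ends : List Walk → Fin t → ℕ
  starts W v = ∑ W (λ P → δ (source P) v)
  ends   W v = ∑ W (λ P → δ (target P) v)

  -- Every vertex is charged for the walks starting there or for those ending
  -- there, so that joining two walks does not change the total.
  budget : List Walk → ℕ
  budget W = ∑ W inner +ℕ ∑ (allFin t) (λ v → starts W v ⊔ ends W v)

  budget-↭ : ∀ {W W′} → W ↭ W′ → budget W ≡ budget W′
  budget-↭ p = cong₂ _+ℕ_ (∑-↭ inner p)
    (∑-cong (allFin t) (λ v → cong₂ _⊔_ (∑-↭ _ p) (∑-↭ _ p)))

  -- Joining raises the sum of `inner` by one. At the common vertex both the starts and the ends
  -- drop by one, so the maximum there drops by one and compensates.
  budget-join : ∀ P Q eq W → budget (join P Q eq ∷ W) ≡ budget (P ∷ Q ∷ W)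
  budget-join P Q eq W = begin
    suc (inner P +ℕ inner Q) +ℕ ∑ W inner +ℕ M          ≡⟨ shift-suc (inner P) (inner Q) _ M ⟩
    inner P +ℕ (inner Q +ℕ ∑ W inner) +ℕ (1 +ℕ M)       ≡⟨ cong (inner P +ℕ (inner Q +ℕ ∑ W inner) +ℕ_) step ⟩
    budget (P ∷ Q ∷ W)                                  ∎
    where
    open ≡-Reasoning
    M = ∑ (allFin t) (λ v → starts (join P Q eq ∷ W) v ⊔ ends (join P Q eq ∷ W) v)

    shift-suc : ∀ x y z u → suc (x +ℕ y) +ℕ z +ℕ u ≡ x +ℕ (y +ℕ z) +ℕ (1 +ℕ u)
    shift-suc = solve-∀

    pointwise : ∀ v → δ (target P) v +ℕ (starts (join P Q eq ∷ W) v ⊔ ends (join P Q eq ∷ W) v) ≡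
                      starts (P ∷ Q ∷ W) v ⊔ ends (P ∷ Q ∷ W) v
    pointwise v rewrite target-join P Q eq | sym eq =
      trans (ℕ.+-distribˡ-⊔ (δ (target P) v) (δ (source P) v +ℕ starts W v) (δ (target Q) v +ℕ ends W v))
            (cong (_⊔ (δ (target P) v +ℕ (δ (target Q) v +ℕ ends W v))) (rotate (δ (target P) v) (δ (source P) v) (starts W v)))
      where
      rotate : ∀ x y z → x +ℕ (y +ℕ z) ≡ y +ℕ (x +ℕ z)
      rotate = solve-∀

    -- The unit is written as the sum of `δ (target P)` over all vertices, so that it can be
    -- absorbed pointwise.
    step : 1 +ℕ M ≡ ∑ (allFin t) (λ v → starts (P ∷ Q ∷ W) v ⊔ ends (P ∷ Q ∷ W) v)
    step = trans (cong (_+ℕ M) (sym (∑-δ (target P))))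
      (trans (sym (∑-+ (δ (target P)) _ (allFin t))) (∑-cong (allFin t) pointwise))

  -- A closed walk adds one start and one end at the same vertex, which raises the maximum there by
  -- exactly one. Together with `inner P` this is its number of edges.
  budget-closed : ∀ P W → target P ≡ source P → suc (inner P) +ℕ budget W ≡ budget (P ∷ W)
  budget-closed P W closed = begin
    suc (inner P) +ℕ (∑ W inner +ℕ M)                   ≡⟨ regroup (inner P) _ M ⟩
    inner P +ℕ ∑ W inner +ℕ (1 +ℕ M)                    ≡⟨ cong (inner P +ℕ ∑ W inner +ℕ_) step ⟩
    budget (P ∷ W)                                      ∎
    where
    open ≡-Reasoning
    M = ∑ (allFin t) (λ v → starts W v ⊔ ends W v)

    regroup : ∀ x y z → suc x +ℕ (y +ℕ z) ≡ x +ℕ y +ℕ (1 +ℕ z)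
    regroup = solve-∀

    pointwise : ∀ v → δ (target P) v +ℕ (starts W v ⊔ ends W v) ≡ starts (P ∷ W) v ⊔ ends (P ∷ W) v
    pointwise v rewrite sym closed = ℕ.+-distribˡ-⊔ (δ (target P) v) (starts W v) (ends W v)

    step : 1 +ℕ M ≡ ∑ (allFin t) (λ v → starts (P ∷ W) v ⊔ ends (P ∷ W) v)
    step = trans (cong (_+ℕ M) (sym (∑-δ (target P))))
      (trans (sym (∑-+ (δ (target P)) _ (allFin t))) (∑-cong (allFin t) pointwise))

  -- Since no walk of `W` starts at the target of `P` or ends at its source, `P` raises the maximum
  -- by one at each of these two vertices. Together with `inner P` this pays for the modulus of
  -- `openMinor P`.
  budget-open : ∀ P W → target P ≢ source P → starts W (target P) ≡ 0 → ends W (source P) ≡ 0 →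
                suc (suc (inner P)) +ℕ budget W ≤ℕ budget (P ∷ W)
  budget-open P W distinct noStart noEnd = begin
    suc (suc (inner P)) +ℕ (∑ W inner +ℕ M)             ≡⟨ regroup (inner P) _ M ⟩
    inner P +ℕ ∑ W inner +ℕ (2 +ℕ M)                    ≤⟨ ℕ.+-monoʳ-≤ (inner P +ℕ ∑ W inner) step ⟩
    budget (P ∷ W)                                      ∎
    where
    open ℕ.≤-Reasoning
    M = ∑ (allFin t) (λ v → starts W v ⊔ ends W v)

    regroup : ∀ x y z → suc (suc x) +ℕ (y +ℕ z) ≡ x +ℕ y +ℕ (2 +ℕ z)
    regroup = solve-∀

    step : 2 +ℕ M ≤ℕ ∑ (allFin t) (λ v → starts (P ∷ W) v ⊔ ends (P ∷ W) v)
    step = begin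
      2 +ℕ M
        ≡⟨ cong (_+ℕ M) (cong₂ _+ℕ_ (∑-δ (source P)) (∑-δ (target P))) ⟨
      ∑ (allFin t) (δ (source P)) +ℕ ∑ (allFin t) (δ (target P)) +ℕ M
        ≡⟨ cong (_+ℕ M) (∑-+ (δ (source P)) (δ (target P)) (allFin t)) ⟨
      ∑ (allFin t) (λ v → δ (source P) v +ℕ δ (target P) v) +ℕ M
        ≡⟨ ∑-+ _ _ (allFin t) ⟨
      ∑ (allFin t) (λ v → δ (source P) v +ℕ δ (target P) v +ℕ (starts W v ⊔ ends W v))
        ≤⟨ ∑-mono (allFin t) (δ-⊔-separate (source P) (target P) (starts W) (ends W) (≢-sym distinct) noEnd noStart) ⟩
      ∑ (allFin t) (λ v → starts (P ∷ W) v ⊔ ends (P ∷ W) v) ∎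

  -- A load of at most 1 means that `j` is not an edge of both `P` and `Q`, so the union counts it
  -- as often as the two walks do.
  load-join : ∀ P Q eq W j → load (P ∷ Q ∷ W) j ≤ℕ 1 → load (join P Q eq ∷ W) j ≡ load (P ∷ Q ∷ W) j
  load-join P Q eq W j le = trans
    (cong (_+ℕ load W j) (ind-∨ (edges P j) (edges Q j)
      (ℕ.m+n≤o⇒m≤o _ (subst (_≤ℕ 1) assoc le))))
    (sym assoc)
    where
    assoc : load (P ∷ Q ∷ W) j ≡ ind (edges P j) +ℕ ind (edges Q j) +ℕ load W j
    assoc = sym (ℕ.+-assoc (ind (edges P j)) _ _)

  -- Greedy decomposition into closed walks and maximal open walks.

  Decomposition : List Walk → Set
  Decomposition W = Σ[ Ms ∈ List (CyclicMinor f) ]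
    (∀ x j → multiplicity Ms x j ≡ load W j) × size Ms ≤ℕ budget W

  -- Induction on the number of walks: the head is either turned into a minor or joined to another
  -- walk, and both leave one walk fewer. The number is a separate argument because a joined list is
  -- not a sublist of the old one.
  decompose : ∀ n W → length W ≡ n → (∀ j → load W j ≤ℕ 1) → Decomposition W

  decompose-join : ∀ n {W} P Q W′ → target P ≡ source Q → W ↭ P ∷ Q ∷ W′ → length W ≡ suc n →
                   (∀ j → load W j ≤ℕ 1) → Decomposition W

  -- Shared by closed and open walks: the budget released by `P` pays for its minor.
  decompose-cons : ∀ n P W M → A M ≡ const true → B M ≡ edges P → k M +ℕ budget W ≤ℕ budget (P ∷ W) →
                   length W ≡ n → (∀ j → load (P ∷ W) j ≤ℕ 1) → Decomposition (P ∷ W)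

  decompose zero    []      len disjoint = [] , (λ _ _ → refl) , z≤n
  decompose (suc n) (P ∷ W) len disjoint with target P ≟ source P
  ... | yes closed = decompose-cons n P W (closedMinor P closed) refl refl
                       (ℕ.≤-reflexive (budget-closed P W closed)) (ℕ.suc-injective len) disjoint
  ... | no distinct with any? (λ Q → source Q ≟ target P) W
  ...   | yes next with Q , W′ , eq , perm ← extract next =
          decompose-join n P Q W′ (sym eq) (prep P perm) len disjoint
  ...   | no noNext with any? (λ Q → target Q ≟ source P) W
  ...     | yes previous with Q , W′ , eq , perm ← extract previous =
            decompose-join n Q P W′ eq (↭-trans (prep P perm) (swap P Q refl)) len disjoint
  ...     | no noPrevious = decompose-cons n P W (openMinor P) refl refl
              (budget-open P W distinct (absent noNext) (absent noPrevious)) (ℕ.suc-injective len) disjoint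
    where
    absent : ∀ {g : Walk → Fin t} {v} → ¬ Any (λ Q → g Q ≡ v) W → ∑ W (λ Q → δ (g Q) v) ≡ 0
    absent {g} {v} none = ∑-zero (All.map δ≡0 (¬Any⇒All¬ W none))
      where
      δ≡0 : ∀ {Q} → g Q ≢ v → δ (g Q) v ≡ 0
      δ≡0 {Q} ne with g Q ≟ v
      ... | yes eq = contradiction eq ne
      ... | no _   = refl

  decompose-join n {W} P Q W′ eq perm len disjoint
    with disjoint′ ← (λ j → subst (_≤ℕ 1) (∑-↭ (λ S → ind (edges S j)) perm) (disjoint j))
    with Ms , covered , small ← decompose n (join P Q eq ∷ W′)
           (ℕ.suc-injective (trans (sym (↭-length perm)) len))
           (λ j → subst (_≤ℕ 1) (trans (∑-↭ _ perm) (sym (load-join P Q eq W′ j (disjoint′ j)))) (disjoint j))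
    = Ms
    , (λ x j → trans (covered x j) (trans (load-join P Q eq W′ j (disjoint′ j)) (sym (∑-↭ _ perm))))
    , subst (size Ms ≤ℕ_) (trans (budget-join P Q eq W′) (sym (budget-↭ perm))) small

  decompose-cons n P W M all-rows same-edges small len disjoint
    with Ms , covered , small′ ← decompose n W len (λ j → ℕ.m+n≤o⇒n≤o (ind (edges P j)) (disjoint j))
    = M ∷ Ms
    , (λ x j → cong₂ _+ℕ_ (cong₂ (λ S S′ → ind (S x ∧ S′ j)) all-rows same-edges) (covered x j))
    , ℕ.≤-trans (ℕ.+-monoʳ-≤ (k M) small′) small

  load-edges : ∀ j → load (map edge (allFin r)) j ≡ 1
  load-edges j = trans (∑-map edge _ (allFin r)) (∑-δ j)

  -- Single edges have `inner` equal to 0, and their starts and ends at a vertex are its out- and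
  -- indegree.
  budget-edges : budget (map edge (allFin r)) ≡ ∑ (allFin t) (λ v → fibreSize g₁ v ⊔ fibreSize g₂ v)
  budget-edges = cong₂ _+ℕ_
    (trans (∑-map edge inner (allFin r)) (trans (∑-const 0 (allFin r)) (ℕ.*-zeroʳ (length (allFin r)))))
    (∑-cong (allFin t) (λ v → cong₂ _⊔_ (∑-map edge _ (allFin r)) (∑-map edge _ (allFin r))))

  walkTiling : Σ[ P ∈ Tiling f ]
               size (tiles P) ≤ℕ ∑ (allFin t) (λ v → fibreSize g₁ v ⊔ fibreSize g₂ v)
  walkTiling with Ms , covered , small ← decompose _ (map edge (allFin r)) refl (λ j → ℕ.≤-reflexive (load-edges j))
    = tiling Ms (λ x j → trans (covered x j) (load-edges j)) , subst (size Ms ≤ℕ_) budget-edges small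

-- Comparing the two tilings of a pair of rows.

hit+hit+⊔ : ∀ o i → hit o +ℕ hit i +ℕ (o ⊔ i) ≤ℕ 1 +ℕ (o +ℕ i)
hit+hit+⊔ zero    zero    = z≤n
hit+hit+⊔ zero    (suc i) = ℕ.≤-refl
hit+hit+⊔ (suc o) zero    = s≤s (s≤s (ℕ.m≤m+n o 0))
-- Both hits count here, but the maximum of two positive numbers is smaller than their sum.
hit+hit+⊔ (suc o) (suc i) = s≤s (s≤s (subst (suc (o ⊔ i) ≤ℕ_) (sym (ℕ.+-suc o i)) (s≤s (ℕ.m⊔n≤m+n o i))))

imageSizes+maxFibres : (g h : Fin r → Fin t) →
  imageSize g +ℕ imageSize h +ℕ ∑ (allFin t) (λ v → fibreSize g v ⊔ fibreSize h v) ≤ℕ t +ℕ (r +ℕ r)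
imageSizes+maxFibres {r} {t} g h = begin
  imageSize g +ℕ imageSize h +ℕ M
    ≡⟨ cong (_+ℕ M) (∑-+ _ _ (allFin t)) ⟨
  ∑ (allFin t) (λ v → hit (o v) +ℕ hit (i v)) +ℕ M
    ≡⟨ ∑-+ _ _ (allFin t) ⟨
  ∑ (allFin t) (λ v → hit (o v) +ℕ hit (i v) +ℕ (o v ⊔ i v))
    ≤⟨ ∑-mono (allFin t) (λ v → hit+hit+⊔ (o v) (i v)) ⟩
  ∑ (allFin t) (λ v → 1 +ℕ (o v +ℕ i v))
    ≡⟨ ∑-+ (const 1) _ (allFin t) ⟩
  ∑ (allFin t) (const 1) +ℕ ∑ (allFin t) (λ v → o v +ℕ i v)
    ≡⟨ cong₂ _+ℕ_ (trans (∑-const 1 (allFin t)) (trans (ℕ.*-identityʳ _) (length-allFin t)))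
                  (trans (∑-+ o i (allFin t)) (cong₂ _+ℕ_ (∑-fibreSize g) (∑-fibreSize h))) ⟩
  t +ℕ (r +ℕ r) ∎
  where
  open ℕ.≤-Reasoning
  o = fibreSize g
  i = fibreSize h
  M = ∑ (allFin t) (λ v → o v ⊔ i v)

m≤n⇒2m≤m+n : m ≤ℕ n → 2 *ℕ m ≤ℕ m +ℕ n
m≤n⇒2m≤m+n {m} m≤n = ℕ.+-monoʳ-≤ m (subst (_≤ℕ _) (sym (ℕ.+-identityʳ m)) m≤n)

-- The cheaper of two tilings costs at most half of their total. The bound is doubled to stay within
-- the natural numbers.
pairTiling : (f : Fin 2 × Fin r → Fin t) →
             Σ[ P ∈ Tiling f ] 2 *ℕ size (tiles P) ≤ℕ 2 *ℕ r +ℕ t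
pairTiling {r} {t} f
  with P₁ , eq₁ ← fibreTiling {f = λ (i , j) → f (i ↑ˡ 1 , j)} (λ j → f (zero , j)) (λ { zero j → refl })
  with P₂ , eq₂ ← fibreTiling {f = λ (i , j) → f (1 ↑ʳ i , j)} (λ j → f (suc zero , j)) (λ { zero j → refl })
  with S , eqS ← stack f P₁ P₂
  with W , W≤ ← walkTiling f = choose (ℕ.≤-total (size (tiles S)) (size (tiles W)))
  where
  rearrange : ∀ t r → t +ℕ (r +ℕ r) ≡ 2 *ℕ r +ℕ t
  rearrange = solve-∀

  total : size (tiles S) +ℕ size (tiles W) ≤ℕ 2 *ℕ r +ℕ t
  total = subst₂ _≤ℕ_ (cong (_+ℕ size (tiles W)) (sym (trans eqS (cong₂ _+ℕ_ eq₁ eq₂)))) (rearrange t r)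
    (ℕ.≤-trans (ℕ.+-monoʳ-≤ _ W≤) (imageSizes+maxFibres (λ j → f (zero , j)) (λ j → f (suc zero , j))))

  choose : size (tiles S) ≤ℕ size (tiles W) ⊎ size (tiles W) ≤ℕ size (tiles S) →
           Σ[ P ∈ Tiling f ] 2 *ℕ size (tiles P) ≤ℕ 2 *ℕ r +ℕ t
  choose (inj₁ S≤W) = S , ℕ.≤-trans (m≤n⇒2m≤m+n S≤W) total
  choose (inj₂ W≤S) = W , ℕ.≤-trans (m≤n⇒2m≤m+n W≤S) (subst (_≤ℕ 2 *ℕ r +ℕ t) (ℕ.+-comm (size (tiles S)) _) total)

-- Tiling all rows, pair by pair, and transport to arbitrary finite sets.

twiceBound : (r t l : ℕ) → ℕ
twiceBound r t 0             = 0
twiceBound r t 1             = 2 *ℕ r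
twiceBound r t (suc (suc l)) = 2 *ℕ r +ℕ t +ℕ twiceBound r t l

finTiling : ∀ l (f : Fin l × Fin r → Fin t) →
            Σ[ P ∈ Tiling f ] 2 *ℕ size (tiles P) ≤ℕ twiceBound r t l
finTiling 0 f = tiling [] (λ ()) , z≤n
finTiling 1 f with P , eq ← fibreTiling {f = f} (λ j → f (zero , j)) (λ { zero j → refl }) =
  P , ℕ.*-monoʳ-≤ 2 (subst (_≤ℕ _) (sym eq) (imageSize≤r (λ j → f (zero , j))))
finTiling {r} {t} (suc (suc l)) f
  with P , P≤ ← pairTiling (λ (i , j) → f (i ↑ˡ l , j))
  with Q , Q≤ ← finTiling l (λ (i , j) → f (2 ↑ʳ i , j))
  with S , eq ← stack {m = 2} f P Q =
  S , subst (_≤ℕ twiceBound r t (suc (suc l)))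
            (sym (trans (cong (2 *ℕ_) eq) (ℕ.*-distribˡ-+ 2 (size (tiles P)) _)))
            (ℕ.+-mono-≤ P≤ Q≤)

-- The minors are pulled back along the bijections. The row map is total here, so each cell keeps
-- its multiplicity.
finiteTiling : L ↔ Fin l → R ↔ Fin r → T ↔ Fin t → (f : L × R → T) →
               Σ[ P ∈ Tiling f ] 2 *ℕ size (tiles P) ≤ℕ twiceBound r t l
finiteTiling {l = l} {r = r} {t = t} φ ψ χ f
  with P , P≤ ← finTiling l (λ (i , j) → Inverse.to χ (f (Inverse.from φ i , Inverse.from ψ j))) =
  tiling (map (pull (just ∘ Inverse.to φ) (Inverse.to ψ) (Inverse.from χ) agree) (tiles P))
         (λ x y → trans (multiplicity-pull _ _ _ agree (tiles P) x y) (once P _ _)) ,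
  subst (λ s → 2 *ℕ s ≤ℕ twiceBound r t l) (sym (size-pull _ _ _ agree (tiles P))) P≤
  where
  agree : ∀ x y {i} → just (Inverse.to φ x) ≡ just i → f (x , y) ≡
          Inverse.from χ (Inverse.to χ (f (Inverse.from φ i , Inverse.from ψ (Inverse.to ψ y))))
  agree x y refl = sym (trans (Inverse.strictlyInverseʳ χ _)
    (cong₂ (λ x y → f (x , y)) (Inverse.strictlyInverseʳ φ x) (Inverse.strictlyInverseʳ ψ y)))

-- From doubled bounds on natural numbers to the rational inequalities.

twiceBound-even : ∀ r t n → twiceBound r t (n *ℕ 2) ≡ n *ℕ (2 *ℕ r +ℕ t)
twiceBound-even r t zero    = refl
twiceBound-even r t (suc n) = cong (2 *ℕ r +ℕ t +ℕ_) (twiceBound-even r t n)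

twiceBound-odd : ∀ r t n → twiceBound r t (suc (n *ℕ 2)) ≡ 2 *ℕ r +ℕ n *ℕ (2 *ℕ r +ℕ t)
twiceBound-odd r t zero    = sym (ℕ.+-identityʳ _)
twiceBound-odd r t (suc n) = trans (cong (2 *ℕ r +ℕ t +ℕ_) (twiceBound-odd r t n))
  (rotate (2 *ℕ r +ℕ t) (2 *ℕ r) _)
  where
  rotate : ∀ x y z → x +ℕ (y +ℕ z) ≡ y +ℕ (x +ℕ z)
  rotate = solve-∀

odd : ∀ l → 2 ∤ l → ∃[ n ] l ≡ suc (n *ℕ 2)
odd 0             2∤l = contradiction (divides 0 refl) 2∤l
odd 1             2∤l = 0 , refl
odd (suc (suc l)) 2∤l with n , eq ← odd l (λ { (divides q eq) → 2∤l (divides (suc q) (cong (2 +ℕ_) eq)) }) =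
  suc n , cong (2 +ℕ_) eq

module _ (n r t : ℕ) where

  private
    -- Without normalisation the denominator computes to 4, so the comparison becomes one of
    -- integers.
    half : ℚᵘ
    half = mkℚᵘ (+ (n *ℕ 2)) 1 ℚᵘ.* (mkℚᵘ (+ r) 0 ℚᵘ.+ mkℚᵘ (+ t) 1)

    toℚᵘ-half : toℚᵘ ((+ (n *ℕ 2)) / 2 * ((+ r) / 1 + (+ t) / 2)) ≃ half
    toℚᵘ-half = ℚᵘ.≃-trans (ℚ.toℚᵘ-homo-* ((+ (n *ℕ 2)) / 2) ((+ r) / 1 + (+ t) / 2))
      (ℚᵘ.*-cong (ℚ.toℚᵘ-fromℚᵘ (mkℚᵘ (+ (n *ℕ 2)) 1))
        (ℚᵘ.≃-trans (ℚ.toℚᵘ-homo-+ ((+ r) / 1) ((+ t) / 2))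
          (ℚᵘ.+-cong (ℚ.toℚᵘ-fromℚᵘ (mkℚᵘ (+ r) 0)) (ℚ.toℚᵘ-fromℚᵘ (mkℚᵘ (+ t) 1)))))

    numerator : ↥ half ≡ + (n *ℕ 2 *ℕ (r *ℕ 2 +ℕ t *ℕ 1))
    numerator = begin
      + (n *ℕ 2) ℤ.* (+ r ℤ.* + 2 ℤ.+ + t ℤ.* + 1)
        ≡⟨ cong (+ (n *ℕ 2) ℤ.*_) (cong₂ ℤ._+_ (ℤ.pos-* r 2) (ℤ.pos-* t 1)) ⟨
      + (n *ℕ 2) ℤ.* + (r *ℕ 2 +ℕ t *ℕ 1)
        ≡⟨ ℤ.pos-* (n *ℕ 2) (r *ℕ 2 +ℕ t *ℕ 1) ⟨
      + (n *ℕ 2 *ℕ (r *ℕ 2 +ℕ t *ℕ 1)) ∎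
      where open ≡-Reasoning

  even-bound : ∀ c → 2 *ℕ c ≤ℕ n *ℕ (2 *ℕ r +ℕ t) →
               (+ c) / 1 ≤ (+ (n *ℕ 2)) / 2 * ((+ r) / 1 + (+ t) / 2)
  even-bound c le = ℚ.toℚᵘ-cancel-≤ (ℚᵘ.≤-respʳ-≃ (ℚᵘ.≃-sym toℚᵘ-half)
    (ℚᵘ.≤-respˡ-≃ (ℚᵘ.≃-sym (ℚ.toℚᵘ-fromℚᵘ (mkℚᵘ (+ c) 0))) (*≤* integral)))
    where
    lhs : ∀ c → 2 *ℕ (2 *ℕ c) ≡ c *ℕ 4
    lhs = solve-∀

    rhs : ∀ n r t → 2 *ℕ (n *ℕ (2 *ℕ r +ℕ t)) ≡ n *ℕ 2 *ℕ (r *ℕ 2 +ℕ t *ℕ 1)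
    rhs = solve-∀

    -- Cross-multiplication puts `c *ℕ 4` on the left, so the already doubled hypothesis is doubled
    -- once more.
    integral : + c ℤ.* ↧ half ℤ.≤ ↥ half ℤ.* + 1
    integral = subst₂ ℤ._≤_ (ℤ.pos-* c 4) (sym (trans (ℤ.*-identityʳ (↥ half)) numerator))
      (ℤ.+≤+ (subst₂ _≤ℕ_ (lhs c) (rhs n r t) (ℕ.*-monoʳ-≤ 2 le)))

  odd-bound : ∀ c → 2 *ℕ c ≤ℕ 2 *ℕ r +ℕ n *ℕ (2 *ℕ r +ℕ t) →
              (+ c) / 1 ≤ (+ r) / 1 + (+ (n *ℕ 2)) / 2 * ((+ r) / 1 + (+ t) / 2)
  odd-bound c le = ℚ.toℚᵘ-cancel-≤ (ℚᵘ.≤-respʳ-≃ (ℚᵘ.≃-sym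
    (ℚᵘ.≃-trans (ℚ.toℚᵘ-homo-+ ((+ r) / 1) _) (ℚᵘ.+-cong (ℚ.toℚᵘ-fromℚᵘ (mkℚᵘ (+ r) 0)) toℚᵘ-half)))
    (ℚᵘ.≤-respˡ-≃ (ℚᵘ.≃-sym (ℚ.toℚᵘ-fromℚᵘ (mkℚᵘ (+ c) 0))) (*≤* integral)))
    where
    whole = mkℚᵘ (+ r) 0 ℚᵘ.+ half

    lhs : ∀ c → 2 *ℕ (2 *ℕ c) ≡ c *ℕ 4
    lhs = solve-∀

    rhs : ∀ n r t → 2 *ℕ (2 *ℕ r +ℕ n *ℕ (2 *ℕ r +ℕ t)) ≡ r *ℕ 4 +ℕ n *ℕ 2 *ℕ (r *ℕ 2 +ℕ t *ℕ 1)
    rhs = solve-∀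

    whole-numerator : ↥ whole ≡ + (r *ℕ 4 +ℕ n *ℕ 2 *ℕ (r *ℕ 2 +ℕ t *ℕ 1))
    whole-numerator = cong₂ ℤ._+_ (sym (ℤ.pos-* r 4)) (trans (ℤ.*-identityʳ (↥ half)) numerator)

    integral : + c ℤ.* ↧ whole ℤ.≤ ↥ whole ℤ.* + 1
    integral = subst₂ ℤ._≤_ (ℤ.pos-* c 4) (sym (trans (ℤ.*-identityʳ (↥ whole)) whole-numerator))
      (ℤ.+≤+ (subst₂ _≤ℕ_ (lhs c) (rhs n r t) (ℕ.*-monoʳ-≤ 2 le)))

lemma4p1 : ∀ {a b c : Level} {L : Set a} {R : Set b} {T : Set c} {l r t : ℕ} →
    L ↔ Fin l → R ↔ Fin r → T ↔ Fin t →
    (f : L × R → T) →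
    Σ[ P ∈ CyclicPartition f ]
    ((2 ∣ l → (+ cost P) / 1 ≤ ((+ l) / 2) * ((+ r) / 1 + (+ t) / 2)) ×
    (2 ∤ l → (+ cost P) / 1 ≤ (+ r) / 1 + (((+ l) - (+ 1)) / 2) * ((+ r) / 1 + (+ t) / 2)))
lemma4p1 {l = l} {r} {t} φ ψ χ f with P , P≤ ← finiteTiling φ ψ χ f = toPartition P , evenCase , oddCase
  where
  evenCase : 2 ∣ l → (+ size (tiles P)) / 1 ≤ ((+ l) / 2) * ((+ r) / 1 + (+ t) / 2)
  evenCase (divides n refl) = even-bound n r t (size (tiles P)) (subst (2 *ℕ size (tiles P) ≤ℕ_) (twiceBound-even r t n) P≤)

  oddCase : 2 ∤ l → (+ size (tiles P)) / 1 ≤ (+ r) / 1 + (((+ l) - (+ 1)) / 2) * ((+ r) / 1 + (+ t) / 2)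
  -- Once `l` is `suc (n *ℕ 2)`, the integer `l - 1` computes to `n *ℕ 2`.
  oddCase 2∤l with n , refl ← odd l 2∤l =
    odd-bound n r t (size (tiles P)) (subst (2 *ℕ size (tiles P) ≤ℕ_) (twiceBound-odd r t n) P≤)
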